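{- For any integer $a \geq 1$ and any $\varepsilon \in (0,1/2)$, there is a loopless multigraph with arboricity $a$, with $n = O(1/\varepsilon)$ vertices and maximum degree $\Delta = O(a)$, for which any $a(1+\varepsilon)$-forest decomposition has diameter $\Omega(1/\varepsilon)$. The constants in $O(\cdot)$ and $\Omega(\cdot)$ are universal.
   Context: The arboricity of a graph is the minimum number of forests into which its edges can be partitioned. A $k$-forest decomposition is a partition of the edges into (at most) $k$ forests. It has diameter $D$ if every tree (connected component) of each of its forests has diameter at most $D$; "any decomposition has diameter $\Omega(1/\varepsilon)$" means that if a decomposition has diameter $D$ then $D \geq c/\varepsilon$ for a universal constant $c>0$. -}

module Defs where

open import Data.Nat as ℕ using (ℕ; suc)
import Data.Nat.Properties as ℕ
open import Data.Integer as ℤ using (+_)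
open import Data.Rational as ℚ
  using (ℚ; 0ℚ; 1ℚ; ½; _+_; _*_; _-_; -_; _/_; 1/_; ∣_∣; _<_; _≤_)
import Data.Rational.Properties as ℚ
open import Data.Rational.Solver using (module +-*-Solver)
open import Data.Fin using (Fin; _≟_)
open import Data.List using (List; []; _∷_; length; map; filter; allFin)
open import Data.List.Extrema.Nat using (max)
open import Data.List.Relation.Unary.Unique.Propositional using (Unique)
open import Data.Product using (Σ; ∃; _×_; _,_; proj₁; proj₂)
open import Data.Sum using (_⊎_)
open import Level using (0ℓ)
open import Relation.Binary.PropositionalEquality
open import Relation.Nullary using (¬_; Dec)
open import Relation.Nullary.Decidable using (_⊎-dec_)
open import Relation.Unary using (Pred)

------------------------------------------------------------------------
-- Real numbers, as Cauchy sequences of rationals with a modulus.  Equality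
-- of reals is never needed below; the orders are the usual ones on limits.

record ℝ : Set where
  constructor mkℝ
  field
    seq    : ℕ → ℚ
    cauchy : ∀ δ → 0ℚ < δ →
             ∃ λ N → ∀ m n → N ℕ.≤ m → N ℕ.≤ n → ∣ seq m - seq n ∣ < δ

open ℝ public

infix  4 _<ℝ_ _≤ℝ_
infixl 6 _+ℝ_
infixl 7 _·_

_<ℝ_ : ℝ → ℝ → Set
x <ℝ y = ∃ λ δ → 0ℚ < δ × ∃ λ N → ∀ n → N ℕ.≤ n → seq x n + δ < seq y n

_≤ℝ_ : ℝ → ℝ → Set
x ≤ℝ y = ∀ δ → 0ℚ < δ → ∃ λ N → ∀ n → N ℕ.≤ n → seq x n < seq y n + δ

fromℚ : ℚ → ℝ
fromℚ p = mkℝ (λ _ → p) λ δ 0<δ →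
  0 , λ _ _ _ _ → subst (_< δ) (cong ∣_∣ (sym (ℚ.+-inverseʳ p))) 0<δ

_+ℝ_ : ℝ → ℝ → ℝ
x +ℝ y = mkℝ (λ n → seq x n + seq y n) λ δ 0<δ →
  let half     = ½ * δ
      0<half   = subst (_< half) (ℚ.*-zeroʳ ½) (ℚ.*-monoʳ-<-pos ½ 0<δ)
      (M , hM) = cauchy x half 0<half
      (N , hN) = cauchy y half 0<half
  in M ℕ.⊔ N , λ m n h h′ →
    let open ℚ.≤-Reasoning
        dx = seq x m - seq x n
        dy = seq y m - seq y n
    in begin-strict
      ∣ (seq x m + seq y m) - (seq x n + seq y n) ∣
        ≡⟨ cong ∣_∣ (rearrange (seq x m) (seq y m) (seq x n) (seq y n)) ⟩
      ∣ dx + dy ∣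
        ≤⟨ ℚ.∣p+q∣≤∣p∣+∣q∣ dx dy ⟩
      ∣ dx ∣ + ∣ dy ∣
        <⟨ ℚ.+-mono-<
             (hM m n (ℕ.m⊔n≤o⇒m≤o M N h) (ℕ.m⊔n≤o⇒m≤o M N h′))
             (hN m n (ℕ.m⊔n≤o⇒n≤o M N h) (ℕ.m⊔n≤o⇒n≤o M N h′)) ⟩
      half + half
        ≡⟨ ℚ.*-distribʳ-+ δ ½ ½ ⟨
      1ℚ * δ
        ≡⟨ ℚ.*-identityˡ δ ⟩
      δ ∎
  where
  rearrange : ∀ a b c d → (a + b) - (c + d) ≡ (a - c) + (b - d)
  rearrange = solve 4 (λ a b c d →
    (a :+ b) :- (c :+ d) := (a :- c) :+ (b :- d)) refl
    where open +-*-Solver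

_·_ : ℚ → ℝ → ℝ
p · x = mkℝ (λ n → p * seq x n) λ δ 0<δ →
  let η       = (1/ s) * δ
      0<η     = subst (_< η) (ℚ.*-zeroʳ (1/ s)) (ℚ.*-monoʳ-<-pos (1/ s) 0<δ)
      (N , h) = cauchy x η 0<η
  in N , λ m n N≤m N≤n →
    let open ℚ.≤-Reasoning
        d = seq x m - seq x n
    in begin-strict
      ∣ p * seq x m - p * seq x n ∣
        ≡⟨ cong ∣_∣ (factor p (seq x m) (seq x n)) ⟩
      ∣ p * d ∣
        ≡⟨ ℚ.∣p*q∣≡∣p∣*∣q∣ p d ⟩
      ∣ p ∣ * ∣ d ∣
        ≤⟨ ℚ.*-monoʳ-≤-nonNeg ∣ d ∣ {{ℚ.∣-∣-nonNeg d}} ∣p∣≤s ⟩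
      s * ∣ d ∣
        <⟨ ℚ.*-monoʳ-<-pos s (h m n N≤m N≤n) ⟩
      s * ((1/ s) * δ)
        ≡⟨ ℚ.*-assoc s (1/ s) δ ⟨
      (s * (1/ s)) * δ
        ≡⟨ cong (_* δ) (ℚ.*-inverseʳ s) ⟩
      1ℚ * δ
        ≡⟨ ℚ.*-identityˡ δ ⟩
      δ ∎
  where
  s : ℚ
  s = ∣ p ∣ + 1ℚ

  instance
    s-pos : ℚ.Positive s
    s-pos = ℚ.nonNeg+pos⇒pos ∣ p ∣ {{ℚ.∣-∣-nonNeg p}} 1ℚ

    s-nonZero : ℚ.NonZero s
    s-nonZero = ℚ.pos⇒nonZero s

    1/s-pos : ℚ.Positive (1/ s)
    1/s-pos = ℚ.1/pos⇒pos s

  ∣p∣≤s : ∣ p ∣ ≤ s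
  ∣p∣≤s = subst (_≤ s) (ℚ.+-identityʳ ∣ p ∣)
            (ℚ.+-monoʳ-≤ ∣ p ∣ (ℚ.nonNegative⁻¹ 1ℚ))

  factor : ∀ a b c → a * b - a * c ≡ a * (b - c)
  factor = solve 3 (λ a b c → a :* b :- a :* c := a :* (b :- c)) refl
    where open +-*-Solver

ℕ→ℚ : ℕ → ℚ
ℕ→ℚ n = + n / 1

------------------------------------------------------------------------
-- Multigraphs

-- Edges are unoriented: the order of the two endpoints is ignored by `Joins`
-- and `Incident`.
record Multigraph : Set where
  field
    order     : ℕ
    size      : ℕ
    endpoints : Fin size → Fin order × Fin order
    loopless  : ∀ e → proj₁ (endpoints e) ≢ proj₂ (endpoints e)

open Multigraph public using (order)

module _ (G : Multigraph) where
  open Multigraph G hiding (order)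

  Vertex : Set
  Vertex = Fin (order G)

  Edge : Set
  Edge = Fin size

  Joins : Edge → Vertex → Vertex → Set
  Joins e u v = endpoints e ≡ (u , v) ⊎ endpoints e ≡ (v , u)

  Incident : Vertex → Edge → Set
  Incident v e = v ≡ proj₁ (endpoints e) ⊎ v ≡ proj₂ (endpoints e)

  incident? : ∀ v e → Dec (Incident v e)
  incident? v e = (v ≟ proj₁ (endpoints e)) ⊎-dec (v ≟ proj₂ (endpoints e))

  degree : Vertex → ℕ
  degree v = length (filter (incident? v) (allFin size))

  maxDegree : ℕ
  maxDegree = max 0 (map degree (allFin (order G)))

  EdgeSet : Set₁
  EdgeSet = Pred Edge 0ℓ

  -- Walks in the spanning subgraph whose edges are those in F.
  data Walk (F : EdgeSet) : Vertex → Vertex → Set where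
    stop : ∀ {u} → Walk F u u
    step : ∀ {u v w} (e : Edge) → F e → Joins e u v → Walk F v w → Walk F u w

  module _ {F : EdgeSet} where

    walkEdges : ∀ {u v} → Walk F u v → List Edge
    walkEdges stop           = []
    walkEdges (step e _ _ w) = e ∷ walkEdges w

    -- All vertices visited except the last one, which for a closed walk is
    -- already listed as the first.
    walkVertices : ∀ {u v} → Walk F u v → List Vertex
    walkVertices stop               = []
    walkVertices (step {u} _ _ _ w) = u ∷ walkVertices w

    walkLength : ∀ {u v} → Walk F u v → ℕ
    walkLength w = length (walkEdges w)

    -- Two parallel edges form a cycle of length 2.
    IsCycle : ∀ {v} → Walk F v v → Set
    IsCycle w = 0 ℕ.< walkLength w × Unique (walkEdges w) × Unique (walkVertices w)

  IsForest : EdgeSet → Set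
  IsForest F = ∀ {v} (w : Walk F v v) → ¬ IsCycle w

  -- Some classes may be empty, so this is a partition into at most k forests.
  record ForestDecomposition (k : ℕ) : Set where
    field
      colour : Edge → Fin k

    forest : Fin k → EdgeSet
    forest i e = colour e ≡ i

    field
      isForest : ∀ i → IsForest (forest i)

  open ForestDecomposition public

  HasArboricity : ℕ → Set
  HasArboricity a =
    ForestDecomposition a × (∀ k → ForestDecomposition k → a ℕ.≤ k)

  IsDistance : EdgeSet → Vertex → Vertex → ℕ → Set
  IsDistance F u v d =
    (Σ (Walk F u v) λ w → walkLength w ≡ d) ×
    (∀ (w : Walk F u v) → d ℕ.≤ walkLength w)

  Component : EdgeSet → Vertex → Pred Vertex 0ℓ
  Component F r v = Walk F r v

  ComponentDiameter≤ : EdgeSet → Vertex → ℕ → Set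
  ComponentDiameter≤ F r D =
    ∀ u v d → Component F r u → Component F r v → IsDistance F u v d → d ℕ.≤ D

  HasDiameter : ∀ {k} → ForestDecomposition k → ℕ → Set
  HasDiameter {k} P D = ∀ i r → ComponentDiameter≤ (forest P i) r D

{-# OPTIONS --safe #-}
-- The graph is the path on M + 2 vertices with each of its M + 1 edges replaced
-- by a parallel strands, where M ≈ 1/(2ε).  A forest contains at most one edge
-- at each position.  If it contains one at every position, it has diameter
-- M + 1.  Otherwise it has at most M edges; if this held for all k forests, then
-- (M + 1) a ≤ k M ≤ a (1 + ε) M, which is impossible for M ε < 1.
module Submission where

open import Defs
open import Data.Nat as ℕ using (ℕ; zero; suc)
import Data.Nat.Properties as ℕ
open import Data.Integer as ℤ using (+_)
import Data.Integer.Properties as ℤ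
import Data.Rational.Properties as ℚ
open import Data.Rational.Unnormalised as ℚᵘ using (mkℚᵘ; *≤*; *≡*)
import Data.Rational.Unnormalised.Properties as ℚᵘ
open import Data.Rational.Solver using (module +-*-Solver)
open import Data.Fin
  using (Fin; zero; suc; toℕ; fromℕ; inject₁; combine; remQuot; punchOut; _≟_)
import Data.Fin.Properties as Fin
open import Data.Fin.Induction using (<-weakInduction)
open import Data.List using (List; []; _∷_; lookup; filter; allFin; map)
open import Data.List.Extrema.Nat using (argmax-all)
open import Data.List.Relation.Unary.All as All using (All; []; _∷_)
import Data.List.Relation.Unary.All.Properties as All
open import Data.List.Relation.Unary.Unique.Propositional using (Unique; []; _∷_)
import Data.List.Relation.Unary.Unique.Propositional.Properties as Unique
open import Data.List.Membership.Propositional.Properties using (∈-lookup)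
open import Data.Product using (Σ; ∃; _×_; _,_; proj₁; proj₂)
open import Data.Sum using (_⊎_; inj₁; inj₂)
open import Function using (id; _∘_; _⇔_; mk⇔; Equivalence; Injective)
open import Function.Construct.Identity using (⇔-id)
open import Function.Construct.Composition using (_⇔-∘_)
open import Function.Construct.Symmetry using (⇔-sym)
open import Level using (0ℓ)
open import Relation.Binary.PropositionalEquality
open import Relation.Nullary using (¬_; yes; no; contradiction)
open import Relation.Nullary.Decidable using (_×-dec_)
open import Relation.Unary using (Pred; Decidable)

-- Rational estimates and the choice of M.

module _ where
  open import Data.Rational
    using (ℚ; mkℚ; 0ℚ; 1ℚ; ½; _+_; _*_; _-_; _/_; ∣_∣; _<_; _≤_; _≤?_; *<*;
           NonNegative; nonNegative; toℚᵘ)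

  toℚᵘ-ℕ→ℚ : ∀ n → toℚᵘ (ℕ→ℚ n) ℚᵘ.≃ mkℚᵘ (+ n) 0
  toℚᵘ-ℕ→ℚ n = ℚ.toℚᵘ-fromℚᵘ (mkℚᵘ (+ n) 0)

  ℕ→ℚ-mono-≤ : ∀ {m n} → m ℕ.≤ n → ℕ→ℚ m ≤ ℕ→ℚ n
  ℕ→ℚ-mono-≤ {m} {n} m≤n = ℚ.toℚᵘ-cancel-≤ (begin
    toℚᵘ (ℕ→ℚ m)  ≃⟨ toℚᵘ-ℕ→ℚ m ⟩
    mkℚᵘ (+ m) 0  ≤⟨ *≤* (ℤ.*-monoʳ-≤-nonNeg (+ 1) (ℤ.+≤+ m≤n)) ⟩
    mkℚᵘ (+ n) 0  ≃⟨ toℚᵘ-ℕ→ℚ n ⟨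
    toℚᵘ (ℕ→ℚ n)  ∎)
    where open ℚᵘ.≤-Reasoning

  ℕ→ℚ-homo-+ : ∀ m n → ℕ→ℚ (m ℕ.+ n) ≡ ℕ→ℚ m + ℕ→ℚ n
  ℕ→ℚ-homo-+ m n = ℚ.toℚᵘ-injective (begin-equality
    toℚᵘ (ℕ→ℚ (m ℕ.+ n))               ≃⟨ toℚᵘ-ℕ→ℚ (m ℕ.+ n) ⟩
    mkℚᵘ (+ (m ℕ.+ n)) 0               ≃⟨ *≡* (cong (ℤ._* + 1) (sym (cong₂ ℤ._+_
                                            (ℤ.*-identityʳ (+ m)) (ℤ.*-identityʳ (+ n))))) ⟩
    mkℚᵘ (+ m) 0 ℚᵘ.+ mkℚᵘ (+ n) 0     ≃⟨ ℚᵘ.+-cong (toℚᵘ-ℕ→ℚ m) (toℚᵘ-ℕ→ℚ n) ⟨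
    toℚᵘ (ℕ→ℚ m) ℚᵘ.+ toℚᵘ (ℕ→ℚ n)     ≃⟨ ℚ.toℚᵘ-homo-+ (ℕ→ℚ m) (ℕ→ℚ n) ⟨
    toℚᵘ (ℕ→ℚ m + ℕ→ℚ n)               ∎)
    where open ℚᵘ.≤-Reasoning

  ℕ→ℚ-homo-* : ∀ m n → ℕ→ℚ (m ℕ.* n) ≡ ℕ→ℚ m * ℕ→ℚ n
  ℕ→ℚ-homo-* m n = ℚ.toℚᵘ-injective (begin-equality
    toℚᵘ (ℕ→ℚ (m ℕ.* n))               ≃⟨ toℚᵘ-ℕ→ℚ (m ℕ.* n) ⟩
    mkℚᵘ (+ (m ℕ.* n)) 0               ≃⟨ *≡* (cong (ℤ._* + 1) (ℤ.pos-* m n)) ⟩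
    mkℚᵘ (+ m) 0 ℚᵘ.* mkℚᵘ (+ n) 0     ≃⟨ ℚᵘ.*-cong (toℚᵘ-ℕ→ℚ m) (toℚᵘ-ℕ→ℚ n) ⟨
    toℚᵘ (ℕ→ℚ m) ℚᵘ.* toℚᵘ (ℕ→ℚ n)     ≃⟨ ℚ.toℚᵘ-homo-* (ℕ→ℚ m) (ℕ→ℚ n) ⟨
    toℚᵘ (ℕ→ℚ m * ℕ→ℚ n)               ∎)
    where open ℚᵘ.≤-Reasoning

  ℕ→ℚ-nonNeg : ∀ n → NonNegative (ℕ→ℚ n)
  ℕ→ℚ-nonNeg n = nonNegative (ℕ→ℚ-mono-≤ {0} {n} ℕ.z≤n)

  p≤∣p∣ : ∀ p → p ≤ ∣ p ∣
  p≤∣p∣ p with 0ℚ ≤? p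
  ... | yes 0≤p = ℚ.≤-reflexive (sym (ℚ.0≤p⇒∣p∣≡p 0≤p))
  ... | no  0≰p = ℚ.≤-trans (ℚ.<⇒≤ (ℚ.≰⇒> 0≰p)) (ℚ.0≤∣p∣ p)

  ∣p-q∣<r⇒p<q+r : ∀ {p q r} → ∣ p - q ∣ < r → p < q + r
  ∣p-q∣<r⇒p<q+r {p} {q} {r} close = begin-strict
    p            ≡⟨ solve 2 (λ p q → p := q :+ (p :- q)) refl p q ⟩
    q + (p - q)  <⟨ ℚ.+-monoʳ-< q (ℚ.≤-<-trans (p≤∣p∣ (p - q)) close) ⟩
    q + r        ∎
    where
    open ℚ.≤-Reasoning
    open +-*-Solver

  archimedean : ∀ q → 0ℚ < q → ∃ λ K → 1ℚ ≤ ℕ→ℚ K * q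
  -- The witness is the denominator of `q`: multiplying by it leaves the numerator, a positive
  -- integer.
  archimedean q@(mkℚ (+ suc n) d _) _ = suc d , ℚ.toℚᵘ-cancel-≤ (begin
    toℚᵘ 1ℚ                               ≤⟨ *≤* (ℤ.+≤+ bound) ⟩
    mkℚᵘ (+ suc d) 0 ℚᵘ.* toℚᵘ q          ≃⟨ ℚᵘ.*-congʳ (toℚᵘ-ℕ→ℚ (suc d)) ⟨
    toℚᵘ (ℕ→ℚ (suc d)) ℚᵘ.* toℚᵘ q        ≃⟨ ℚ.toℚᵘ-homo-* (ℕ→ℚ (suc d)) q ⟨
    toℚᵘ (ℕ→ℚ (suc d) * q)                ∎)
    where
    open ℚᵘ.≤-Reasoning
    bound : 1 ℕ.* (1 ℕ.* suc d) ℕ.≤ suc d ℕ.* suc n ℕ.* 1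
    bound = ℕ.≤-trans (ℕ.≤-reflexive (trans (ℕ.*-identityˡ _) (ℕ.*-identityˡ _)))
      (ℕ.≤-trans (ℕ.m≤m*n (suc d) (suc n)) (ℕ.≤-reflexive (sym (ℕ.*-identityʳ _))))
  archimedean (mkℚ (+ zero) _ _)  (*<* (ℤ.+<+ ()))
  archimedean (mkℚ ℤ.-[1+ _ ] _ _) (*<* ())

  -- The search runs downward from `n`, carrying the failure of `P` at the current index, and must
  -- stop by 0.
  crossing : {P : Pred ℕ 0ℓ} → Decidable P → ∀ {n} → P 0 → ¬ P n →
             ∃ λ m → P m × ¬ P (suc m)
  crossing P? {zero}  P0 ¬Pn = contradiction P0 ¬Pn
  crossing P? {suc n} P0 ¬Pn with P? n
  ... | yes Pn  = n , Pn , ¬Pn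
  ... | no  ¬Pm = crossing P? P0 ¬Pm

  -- The `M` found is the floor of 1/(2q). The search for it is bounded because some multiple `K q`
  -- reaches 1, which exceeds ½.
  ½-scale : ∀ q → 0ℚ < q → ∃ λ M → ℕ→ℚ M * q ≤ ½ × ½ ≤ ℕ→ℚ (suc M) * q
  ½-scale q 0<q =
    let K , 1≤Kq = archimedean q 0<q
        M , below , above = crossing (λ m → ℕ→ℚ m * q ≤? ½) {K}
          (subst (_≤ ½) (sym (ℚ.*-zeroˡ q)) (ℚ.nonNegative⁻¹ ½))
          (λ Kq≤½ → ℚ.<-irrefl refl (ℚ.<-≤-trans ½<1 (ℚ.≤-trans 1≤Kq Kq≤½)))
    in M , below , ℚ.<⇒≤ (ℚ.≰⇒> above)
    where
    ½<1 : ½ < 1ℚ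
    ½<1 = *<* (ℤ.+<+ ℕ.≤-refl)

  ⅓ ¾ ¼ ⅛ 3/2 2/3 : ℚ
  ⅓ = + 1 / 3
  ¾ = + 3 / 4
  ¼ = + 1 / 4
  ⅛ = + 1 / 8
  3/2 = + 3 / 2
  2/3 = + 2 / 3

  p<p+q : ∀ p {q} → 0ℚ < q → p < p + q
  p<p+q p 0<q = subst (_< p + _) (ℚ.+-identityʳ p) (ℚ.+-monoʳ-< p 0<q)

  -- Here `x` will be a term of ε and `η` the error allowed in k ≤ a (1 + ε). Then k M exceeds M a
  -- by at most ¾ a + ⅛, and this is less than a because ⅛ < ¼ ≤ ¼ a.
  [1+M]a≰kM : ∀ M a k {x η} → 1 ℕ.≤ a → ℕ→ℚ M * x ≤ ¾ → ℕ→ℚ M * η ≤ ⅛ →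
    ℕ→ℚ k < ℕ→ℚ a * (1ℚ + x) + η → ¬ (suc M ℕ.* a ℕ.≤ k ℕ.* M)
  [1+M]a≰kM M a k {x} {η} 1≤a Mx≤¾ Mη≤⅛ k< edges = ℚ.<-irrefl refl (begin-strict
    A + m * A                           ≡⟨ cong (λ z → A + z) (ℕ→ℚ-homo-* M a) ⟨
    A + ℕ→ℚ (M ℕ.* a)                   ≡⟨ ℕ→ℚ-homo-+ a (M ℕ.* a) ⟨
    ℕ→ℚ (suc M ℕ.* a)                   ≤⟨ ℕ→ℚ-mono-≤ edges ⟩
    ℕ→ℚ (k ℕ.* M)                       ≡⟨ ℕ→ℚ-homo-* k M ⟩
    ℕ→ℚ k * m                           ≤⟨ ℚ.*-monoʳ-≤-nonNeg m (ℚ.<⇒≤ k<) ⟩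
    (A * (1ℚ + x) + η) * m              ≡⟨ solve 4 (λ a x η m →
      (a :* (con 1ℚ :+ x) :+ η) :* m := m :* a :+ a :* (m :* x) :+ m :* η) refl A x η m ⟩
    m * A + A * (m * x) + m * η         ≤⟨ ℚ.+-mono-≤ (ℚ.+-monoʳ-≤ (m * A)
                                             (ℚ.*-monoˡ-≤-nonNeg A Mx≤¾)) Mη≤⅛ ⟩
    m * A + A * ¾ + ⅛                   <⟨ ℚ.+-monoʳ-< (m * A + A * ¾) ⅛<¼ ⟩
    m * A + A * ¾ + ¼ * 1ℚ              ≤⟨ ℚ.+-monoʳ-≤ (m * A + A * ¾)
                                             (ℚ.*-monoˡ-≤-nonNeg ¼ (ℕ→ℚ-mono-≤ 1≤a)) ⟩
    m * A + A * ¾ + ¼ * A               ≡⟨ solve 2 (λ a m →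
      m :* a :+ a :* con ¾ :+ con ¼ :* a := a :+ m :* a) refl A m ⟩
    A + m * A                           ∎)
    where
    open ℚ.≤-Reasoning
    open +-*-Solver

    A m : ℚ
    A = ℕ→ℚ a
    m = ℕ→ℚ M

    instance
      A-nonNeg : NonNegative A
      A-nonNeg = ℕ→ℚ-nonNeg a

      m-nonNeg : NonNegative m
      m-nonNeg = ℕ→ℚ-nonNeg M

    ⅛<¼ : ⅛ < ¼
    ⅛<¼ = *<* (ℤ.+<+ (ℕ.m≤m+n 5 3))

  -- The slack absorbs the error δ which _≤ℝ_ allows in k ≤ a (1 + ε).
  record Scale (ε : ℝ) (M : ℕ) : Set where
    field
      from        : ℕ
      nonneg      : ∀ {n} → from ℕ.≤ n → 0ℚ ≤ seq ε n
      upper       : ∀ {n} → from ℕ.≤ n → ℕ→ℚ M * seq ε n ≤ ¾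
      lower       : ∀ {n} → from ℕ.≤ n → ⅓ ≤ ℕ→ℚ (suc M) * seq ε n
      slack       : ℚ
      slack-pos   : 0ℚ < slack
      slack-bound : ℕ→ℚ M * slack ≤ ⅛

  -- `M` is computed from the single term `q`. From `N` on, any two terms agree up to a factor 3/2,
  -- which weakens M q ≤ ½ to the bound ¾ and ½ ≤ (M + 1) q to the bound ⅓ for every later term.
  ∃-scale : ∀ ε → fromℚ 0ℚ <ℝ ε → ∃ (Scale ε)
  ∃-scale ε (δ , 0<δ , N₀ , above-δ) =
    M , record
      { from        = N
      ; nonneg      = λ {n} N≤n → ℚ.<⇒≤ (ℚ.<-trans 0<δ (δ< n N≤n))
      ; upper       = λ {n} → upper n
      ; lower       = λ {n} → lower n
      -- Since M q ≤ ½, a quarter of `q` keeps the product with M within ⅛.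
      ; slack       = ¼ * q
      ; slack-pos   = ℚ.*-monoʳ-<-pos ¼ 0<q
      ; slack-bound = slack-bound
      }
    where
    open ℚ.≤-Reasoning
    open +-*-Solver

    half : 0ℚ < ½ * δ
    half = ℚ.*-monoʳ-<-pos ½ 0<δ

    N₂ N : ℕ
    N₂ = proj₁ (cauchy ε (½ * δ) half)
    N  = N₀ ℕ.⊔ N₂

    q : ℚ
    q = seq ε N

    δ< : ∀ n → N ℕ.≤ n → δ < seq ε n
    δ< n N≤n = subst (_< seq ε n) (ℚ.+-identityˡ δ) (above-δ n (ℕ.m⊔n≤o⇒m≤o N₀ N₂ N≤n))

    -- The terms exceed δ, so the absolute error ½ δ is less than half of a term. This makes the
    -- error relative.
    close : ∀ m n → N ℕ.≤ m → N ℕ.≤ n → seq ε m ≤ 3/2 * seq ε n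
    close m n N≤m N≤n = begin
      seq ε m                  <⟨ ∣p-q∣<r⇒p<q+r (proj₂ (cauchy ε (½ * δ) half) m n
                                    (ℕ.m⊔n≤o⇒n≤o N₀ N₂ N≤m) (ℕ.m⊔n≤o⇒n≤o N₀ N₂ N≤n)) ⟩
      seq ε n + ½ * δ          <⟨ ℚ.+-monoʳ-< (seq ε n) (ℚ.*-monoʳ-<-pos ½ (δ< n N≤n)) ⟩
      seq ε n + ½ * seq ε n    ≡⟨ solve 1 (λ x → x :+ con ½ :* x := con 3/2 :* x) refl (seq ε n) ⟩
      3/2 * seq ε n            ∎

    0<q : 0ℚ < q
    0<q = ℚ.<-trans 0<δ (δ< N ℕ.≤-refl)

    M : ℕ
    M = proj₁ (½-scale q 0<q)

    Mq≤½ : ℕ→ℚ M * q ≤ ½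
    Mq≤½ = proj₁ (proj₂ (½-scale q 0<q))

    ½≤[1+M]q : ½ ≤ ℕ→ℚ (suc M) * q
    ½≤[1+M]q = proj₂ (proj₂ (½-scale q 0<q))

    instance
      M-nonNeg : NonNegative (ℕ→ℚ M)
      M-nonNeg = ℕ→ℚ-nonNeg M

      1+M-nonNeg : NonNegative (ℕ→ℚ (suc M))
      1+M-nonNeg = ℕ→ℚ-nonNeg (suc M)

    slack-bound : ℕ→ℚ M * (¼ * q) ≤ ⅛
    slack-bound = begin
      ℕ→ℚ M * (¼ * q)  ≡⟨ solve 2 (λ m q → m :* (con ¼ :* q) := con ¼ :* (m :* q)) refl (ℕ→ℚ M) q ⟩
      ¼ * (ℕ→ℚ M * q)  ≤⟨ ℚ.*-monoˡ-≤-nonNeg ¼ Mq≤½ ⟩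
      ¼ * ½            ∎

    upper : ∀ n → N ℕ.≤ n → ℕ→ℚ M * seq ε n ≤ ¾
    upper n N≤n = begin
      ℕ→ℚ M * seq ε n    ≤⟨ ℚ.*-monoˡ-≤-nonNeg (ℕ→ℚ M) (close n N N≤n ℕ.≤-refl) ⟩
      ℕ→ℚ M * (3/2 * q)  ≡⟨ solve 2 (λ m q → m :* (con 3/2 :* q) := con 3/2 :* (m :* q)) refl (ℕ→ℚ M) q ⟩
      3/2 * (ℕ→ℚ M * q)  ≤⟨ ℚ.*-monoˡ-≤-nonNeg 3/2 Mq≤½ ⟩
      3/2 * ½            ∎

    lower : ∀ n → N ℕ.≤ n → ⅓ ≤ ℕ→ℚ (suc M) * seq ε n
    lower n N≤n = begin
      2/3 * ½                                  ≤⟨ ℚ.*-monoˡ-≤-nonNeg 2/3 ½≤[1+M]q ⟩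
      2/3 * (ℕ→ℚ (suc M) * q)                  ≤⟨ ℚ.*-monoˡ-≤-nonNeg 2/3
        (ℚ.*-monoˡ-≤-nonNeg (ℕ→ℚ (suc M)) (close N n ℕ.≤-refl N≤n)) ⟩
      2/3 * (ℕ→ℚ (suc M) * (3/2 * seq ε n))    ≡⟨ solve 2 (λ l x →
        con 2/3 :* (l :* (con 3/2 :* x)) := l :* x) refl (ℕ→ℚ (suc M)) (seq ε n) ⟩
      ℕ→ℚ (suc M) * seq ε n                    ∎

  module _ {ε M} (scale : Scale ε M) where
    open Scale scale

    -- The two vertices beyond M contribute at most 2 · ½ because ε < ½, and M contributes at most
    -- ¾; the total 1 + ¾ is below 2.
    order-bound : ε <ℝ fromℚ ½ → ℕ→ℚ (2 ℕ.+ M) · ε ≤ℝ fromℚ (ℕ→ℚ 2)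
    order-bound (δ₁ , 0<δ₁ , N₁ , below-½) δ 0<δ = N₁ ℕ.⊔ from , λ n N≤n →
      let x   = seq ε n
          x<½ = ℚ.<-trans (p<p+q x 0<δ₁) (below-½ n (ℕ.m⊔n≤o⇒m≤o N₁ from N≤n))
      in begin-strict
        ℕ→ℚ (2 ℕ.+ M) * x        ≡⟨ cong (_* x) (ℕ→ℚ-homo-+ 2 M) ⟩
        (ℕ→ℚ 2 + ℕ→ℚ M) * x      ≡⟨ ℚ.*-distribʳ-+ x (ℕ→ℚ 2) (ℕ→ℚ M) ⟩
        ℕ→ℚ 2 * x + ℕ→ℚ M * x    ≤⟨ ℚ.+-mono-≤ (ℚ.*-monoˡ-≤-nonNeg (ℕ→ℚ 2) (ℚ.<⇒≤ x<½))
                                      (upper (ℕ.m⊔n≤o⇒n≤o N₁ from N≤n)) ⟩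
        1ℚ + ¾                   <⟨ ℚ.+-monoʳ-< 1ℚ ¾<1 ⟩
        ℕ→ℚ 2                    <⟨ p<p+q (ℕ→ℚ 2) 0<δ ⟩
        ℕ→ℚ 2 + δ                ∎
      where
      open ℚ.≤-Reasoning
      ¾<1 : ¾ < 1ℚ
      ¾<1 = *<* (ℤ.+<+ ℕ.≤-refl)

    ⅓≤D·ε : ∀ {D} → M ℕ.< D → fromℚ ⅓ ≤ℝ ℕ→ℚ D · ε
    ⅓≤D·ε {D} M<D δ 0<δ = from , λ n from≤n →
      let x = seq ε n
          instance
            x-nonNeg = nonNegative (nonneg from≤n)
      in begin-strict
        ⅓                    ≤⟨ lower from≤n ⟩
        ℕ→ℚ (suc M) * x      ≤⟨ ℚ.*-monoʳ-≤-nonNeg x (ℕ→ℚ-mono-≤ M<D) ⟩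
        ℕ→ℚ D * x            <⟨ p<p+q (ℕ→ℚ D * x) 0<δ ⟩
        ℕ→ℚ D * x + δ        ∎
      where open ℚ.≤-Reasoning

    -- The real inequality is needed only with error `slack` and at one index past both thresholds,
    -- which reduces the claim to rationals.
    k≤a[1+ε]⇒[1+M]a≰kM : ∀ a k → 1 ℕ.≤ a → fromℚ (ℕ→ℚ k) ≤ℝ ℕ→ℚ a · (fromℚ 1ℚ +ℝ ε) →
                         ¬ (suc M ℕ.* a ℕ.≤ k ℕ.* M)
    k≤a[1+ε]⇒[1+M]a≰kM a k 1≤a k≤a[1+ε] with N , k< ← k≤a[1+ε] slack slack-pos =
      [1+M]a≰kM M a k 1≤a (upper (ℕ.m≤m⊔n from N)) slack-bound
        (k< (from ℕ.⊔ N) (ℕ.m≤n⊔m from N))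

open import Data.Nat using (ℕ; _≤_; _*_)
open import Data.Rational using (ℚ; 0ℚ; 1ℚ; ½; _<_)

-- Parallel edges and degrees in multigraphs.

lookup-injective : ∀ {A : Set} {xs : List A} → Unique xs →
                   ∀ i j → lookup xs i ≡ lookup xs j → i ≡ j
lookup-injective (x∉xs ∷ xs!) zero    zero    eq = refl
lookup-injective (x∉xs ∷ xs!) zero    (suc j) eq =
  contradiction eq (All.lookup x∉xs (∈-lookup j))
lookup-injective (x∉xs ∷ xs!) (suc i) zero    eq =
  contradiction (sym eq) (All.lookup x∉xs (∈-lookup i))
lookup-injective (x∉xs ∷ xs!) (suc i) (suc j) eq =
  cong suc (lookup-injective xs! i j eq)

module _ (G : Multigraph) where
  open Multigraph G using (endpoints; loopless)

  -- If the edges differed, going out along `e` and back along `f` would be a cycle of length 2; its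
  -- two vertices are distinct by looplessness.
  parallel-edges-≡ : ∀ {F e f} → IsForest G F → F e → F f →
                     endpoints e ≡ endpoints f → e ≡ f
  parallel-edges-≡ {F} {e} {f} forest-F e∈F f∈F same with e ≟ f
  ... | yes e≡f = e≡f
  ... | no  e≢f = contradiction
    (ℕ.z<s , ((e≢f ∷ []) ∷ [] ∷ []) , ((loopless e ∷ []) ∷ [] ∷ []))
    (forest-F (step e e∈F (inj₁ refl) (step f f∈F (inj₂ (sym same)) stop)))

  -- The code may depend on the incidence proof, so it can record which end of the edge lies at `v`.
  degree-≤ : ∀ {n} v (code : ∀ e → Incident G v e → Fin n) →
             (∀ {e f} i j → code e i ≡ code f j → e ≡ f) → degree G v ≤ n
  degree-≤ v code code-injective = Fin.injective⇒≤ {f = code′} λ eq →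
    lookup-injective
      (Unique.filter⁺ (incident? G v) (Unique.allFin⁺ _)) _ _ (code-injective _ _ eq)
    where
    edges = filter (incident? G v) (allFin _)
    code′ = λ i → code (lookup edges i)
      (All.lookup (All.all-filter (incident? G v) (allFin _)) (∈-lookup i))

  maxDegree-≤ : ∀ {n} → (∀ v → degree G v ≤ n) → maxDegree G ≤ n
  -- `ℕ.z≤n` covers the default value 0 of `max`.
  maxDegree-≤ {n} bound = argmax-all id {P = _≤ n} {xs = map (degree G) (allFin _)} ℕ.z≤n
    (All.map⁺ (All.universal bound _))

-- The path with m positions and a strands.

module FatPath (m a : ℕ) where

  -- Edges must be numbered by a `Fin`, so a pair of position and strand is packed into
  -- `Fin (m * a)`; `remQuot` unpacks it.
  position : Fin (m * a) → Fin m
  position = proj₁ ∘ remQuot a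

  strand : Fin (m * a) → Fin a
  strand = proj₂ ∘ remQuot {m} a

  position-strand-injective : ∀ {e f} → position e ≡ position f →
                              strand e ≡ strand f → e ≡ f
  position-strand-injective {e} {f} p s = begin
    e                               ≡⟨ Fin.combine-remQuot {m} a e ⟨
    combine (position e) (strand e) ≡⟨ cong₂ combine p s ⟩
    combine (position f) (strand f) ≡⟨ Fin.combine-remQuot {m} a f ⟩
    f                               ∎
    where open ≡-Reasoning

  ends : Fin m → Fin (suc m) × Fin (suc m)
  ends p = inject₁ p , suc p

  fatPath : Multigraph
  fatPath = record
    { order     = suc m
    ; size      = m * a
    ; endpoints = ends ∘ position
    ; loopless  = λ e eq → ℕ.m≢1+m+n _
        (trans (sym (Fin.toℕ-inject₁ (position e)))
          (trans (cong toℕ eq) (cong suc (sym (ℕ.+-identityʳ _)))))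
    }

  ends-toℕ : ∀ {p u v} → ends p ≡ (u , v) → toℕ u ≡ toℕ p × toℕ v ≡ suc (toℕ p)
  ends-toℕ {p} refl = Fin.toℕ-inject₁ p , refl

  same-position : ∀ {F e f} → IsForest fatPath F → F e → F f →
                  position e ≡ position f → e ≡ f
  same-position forest-F e∈F f∈F eq =
    parallel-edges-≡ fatPath forest-F e∈F f∈F (cong ends eq)

  -- A vertex is the left end of at most one position and the right end of at most one, so the side
  -- and the strand determine an incident edge.
  maxDegree-fatPath : maxDegree fatPath ≤ 2 * a
  maxDegree-fatPath = maxDegree-≤ fatPath λ v →
    degree-≤ fatPath v code (code-injective {v})
    where
    code : ∀ {v} e → Incident fatPath v e → Fin (2 * a)
    code e (inj₁ _) = combine {2} zero (strand e)
    code e (inj₂ _) = combine {2} (suc zero) (strand e)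

    code-injective : ∀ {v e f} i j → code {v} e i ≡ code f j → e ≡ f
    code-injective (inj₁ p) (inj₁ q) eq = position-strand-injective
      (Fin.inject₁-injective (trans (sym p) q))
      (Fin.combine-injectiveʳ {2} zero _ zero _ eq)
    code-injective (inj₂ p) (inj₂ q) eq = position-strand-injective
      (Fin.suc-injective (trans (sym p) q))
      (Fin.combine-injectiveʳ {2} (suc zero) _ (suc zero) _ eq)
    code-injective {e = e} {f} (inj₁ _) (inj₂ _) eq =
      contradiction (Fin.combine-injectiveˡ {2} zero (strand e) (suc zero) (strand f) eq) λ ()
    code-injective {e = e} {f} (inj₂ _) (inj₁ _) eq =
      contradiction (Fin.combine-injectiveˡ {2} (suc zero) (strand e) zero (strand f) eq) λ ()

  -- Cuts of the path and forests.

  -- The cut at `p` splits the vertices into those up to `p` and those after it. An edge at position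
  -- q runs from q to q + 1, and for q different from `p` the bounds q ≤ p and q + 1 ≤ p are
  -- equivalent.
  cut-edge : ∀ {e u v p} → Joins fatPath e u v → position e ≢ p →
             (toℕ u ≤ toℕ p) ⇔ (toℕ v ≤ toℕ p)
  cut-edge {e} {p = p} joins q≢p = side joins
    where
    ordered : ∀ {u v} → ends (position e) ≡ (u , v) →
              (toℕ u ≤ toℕ p) ⇔ (toℕ v ≤ toℕ p)
    ordered eq with u≡ , v≡ ← ends-toℕ eq rewrite u≡ | v≡ =
      mk⇔ (λ q≤p → ℕ.≤∧≢⇒< q≤p (q≢p ∘ Fin.toℕ-injective)) ℕ.<⇒≤

    side : ∀ {u v} → Joins fatPath e u v → (toℕ u ≤ toℕ p) ⇔ (toℕ v ≤ toℕ p)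
    side (inj₁ eq) = ordered eq
    side (inj₂ eq) = ⇔-sym (ordered eq)

  cut-walk : ∀ {F u v p} (w : Walk fatPath F u v) →
             All (λ e → position e ≢ p) (walkEdges fatPath w) →
             (toℕ u ≤ toℕ p) ⇔ (toℕ v ≤ toℕ p)
  cut-walk stop               []       = ⇔-id _
  cut-walk (step e _ joins w) (h ∷ hs) = cut-walk w hs ⇔-∘ cut-edge joins h

  cut-separates : ∀ {e u v} → Joins fatPath e u v →
    ¬ ((toℕ u ≤ toℕ (position e)) ⇔ (toℕ v ≤ toℕ (position e)))
  cut-separates (inj₁ eq) same with u≡ , v≡ ← ends-toℕ eq =
    ℕ.<⇒≱ (ℕ.≤-reflexive (sym v≡)) (Equivalence.to same (ℕ.≤-reflexive u≡))
  cut-separates (inj₂ eq) same with v≡ , u≡ ← ends-toℕ eq =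
    ℕ.<⇒≱ (ℕ.≤-reflexive (sym u≡)) (Equivalence.from same (ℕ.≤-reflexive v≡))

  -- A closed trail through e cannot return across the cut at the position of e,
  -- since e is the only edge of F there.
  isForest-from-positions : ∀ {F} →
    (∀ {e f} → F e → F f → position e ≡ position f → e ≡ f) → IsForest fatPath F
  isForest-from-positions simple stop (() , _)
  isForest-from-positions {F} simple (step e e∈F joins w) (_ , e∉w ∷ _ , _) =
    cut-separates joins (⇔-sym (cut-walk w (other-positions w e∉w)))
    where
    other-positions : ∀ {u v} (w : Walk fatPath F u v) →
      All (e ≢_) (walkEdges fatPath w) →
      All (λ f → position f ≢ position e) (walkEdges fatPath w)
    other-positions stop             []           = []
    other-positions (step f f∈F _ w) (e≢f ∷ rest) =
      (λ eq → e≢f (simple e∈F f∈F (sym eq))) ∷ other-positions w rest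

  -- Each colour class is a simple path, with one edge at every position.
  strands : ForestDecomposition fatPath a
  strands = record
    { colour   = strand
    ; isForest = λ i → isForest-from-positions λ e∈ f∈ p →
        position-strand-injective p (trans e∈ (sym f∈))
    }

  -- Distances and diameter.

  -- Each step lowers the vertex number by at most 1. Adding the final vertex on the right avoids
  -- subtraction.
  walkLength-≥ : ∀ {F u v} (w : Walk fatPath F u v) →
                 toℕ u ≤ walkLength fatPath w ℕ.+ toℕ v
  walkLength-≥ stop = ℕ.≤-refl
  walkLength-≥ (step {u} {v} e _ joins w) =
    ℕ.≤-trans (next joins) (ℕ.s≤s (walkLength-≥ w))
    where
    next : Joins fatPath e u v → toℕ u ≤ suc (toℕ v)
    next (inj₁ eq) with u≡ , v≡ ← ends-toℕ eq =
      ℕ.≤-trans (ℕ.≤-reflexive u≡) (ℕ.m≤n⇒m≤1+n (ℕ.<⇒≤ (ℕ.≤-reflexive (sym v≡))))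
    next (inj₂ eq) with v≡ , u≡ ← ends-toℕ eq =
      ℕ.≤-reflexive (trans u≡ (cong suc (sym v≡)))

  -- The walk descends to `zero`, so that induction on its start puts the new edge in front, as
  -- `step` requires.
  full⇒walk : ∀ {F} → (∀ p → ∃ λ e → F e × position e ≡ p) →
              ∀ v → Σ (Walk fatPath F v zero) λ w → walkLength fatPath w ≡ toℕ v
  full⇒walk full = <-weakInduction _ (stop , refl) extend
    where
    extend : ∀ p → (Σ (Walk fatPath _ (inject₁ p) zero) λ w → _ ≡ toℕ (inject₁ p)) →
             Σ (Walk fatPath _ (suc p) zero) λ w → _ ≡ suc (toℕ p)
    extend p (w , len) with e , e∈F , refl ← full p =
      -- The edge is traversed from its right end to its left end, hence `inj₂`.
      step e e∈F (inj₂ refl) w , cong suc (trans len (Fin.toℕ-inject₁ p))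

  module _ {k} (P : ForestDecomposition fatPath k) where

    -- Both the lower bound on arboricity and the edge count rest on this injection: one colour
    -- class is a forest, and parallel edges in it would form a cycle.
    colour-position-injective : ∀ {e f} → colour P e ≡ colour P f →
                                position e ≡ position f → e ≡ f
    colour-position-injective same =
      same-position (isForest P _) same refl

    -- The two ends of the path are at distance exactly `m` in this forest: the descending walk
    -- attains `m`, and `walkLength-≥` shows that no walk is shorter.
    full⇒diameter-≥ : ∀ {D} → HasDiameter fatPath P D → ∀ i →
                      (∀ p → ∃ λ e → forest P i e × position e ≡ p) → m ≤ D
    full⇒diameter-≥ diam i full =
      diam i top top zero m stop w
        ((w , trans len (Fin.toℕ-fromℕ m)) , λ w′ → begin
          m                              ≡⟨ Fin.toℕ-fromℕ m ⟨
          toℕ top                        ≤⟨ walkLength-≥ w′ ⟩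
          walkLength fatPath w′ ℕ.+ 0    ≡⟨ ℕ.+-identityʳ _ ⟩
          walkLength fatPath w′          ∎)
      where
      open ℕ.≤-Reasoning hiding (stop)
      top = fromℕ m
      w   = proj₁ (full⇒walk full top)
      len = proj₂ (full⇒walk full top)

    -- Whether a colour occurs at a position is decidable by search over the edges, so the failure
    -- to occur everywhere yields an actual missed position.
    missed-position : ∀ {D} → HasDiameter fatPath P D → D ℕ.< m → ∀ i →
                      ∃ λ p → ∀ e → colour P e ≡ i → position e ≢ p
    missed-position diam D<m i
      with p , missed ← Fin.¬∀⟶∃¬ m _
             (λ p → Fin.any? λ e → colour P e ≟ i ×-dec position e ≟ p)
             (ℕ.<⇒≱ D<m ∘ full⇒diameter-≥ diam i)
      = p , λ e e∈i at-p → missed (e , e∈i , at-p)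

-- Arboricity and the edge count.

-- The strands give the upper bound. For the lower bound, the `a` parallel edges at position `zero`
-- need distinct colours; `suc m` ensures that this position exists.
arboricity-fatPath : ∀ m a → HasArboricity (FatPath.fatPath (suc m) a) a
arboricity-fatPath m a = strands , λ k P →
  Fin.injective⇒≤ {f = λ s → colour P (combine {suc m} zero s)} λ {s} {t} eq →
    Fin.combine-injectiveʳ {suc m} zero s zero t
      (colour-position-injective P eq (trans (at-zero s) (sym (at-zero t))))
  where
  open FatPath (suc m) a
  at-zero : ∀ s → position (combine {suc m} zero s) ≡ zero
  at-zero s = cong proj₁ (Fin.remQuot-combine {suc m} zero s)

-- Every class misses one of the M + 1 positions. After `punchOut` of that position an edge has a
-- rank in `Fin M`, and its colour and rank determine it.
short⇒edge-bound : ∀ M a {k D} (P : ForestDecomposition (FatPath.fatPath (suc M) a) k) →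
  HasDiameter _ P D → D ℕ.< suc M → suc M * a ≤ k * M
short⇒edge-bound M a {k} P diam D<m = Fin.injective⇒≤ {f = code} code-injective
  where
  open FatPath (suc M) a

  missing : Fin k → Fin (suc M)
  missing i = proj₁ (missed-position P diam D<m i)

  avoids : ∀ e i → colour P e ≡ i → missing i ≢ position e
  avoids e i e∈i eq = proj₂ (missed-position P diam D<m i) e e∈i (sym eq)

  code : Fin (suc M * a) → Fin (k * M)
  code e = combine (colour P e) (punchOut (avoids e (colour P e) refl))

  code-injective : Injective _≡_ _≡_ code
  code-injective {e} {f} eq
    with same-colour , same-rank ← Fin.combine-injective (colour P e) _ (colour P f) _ eq =
    colour-position-injective P same-colour
      (same-position-if (colour P e) (colour P f) same-colour _ _ same-rank)
    where
    -- The colours are generalised to variables so that their equality can be matched with `refl`;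
    -- the punched-out positions then coincide and the ranks can be compared.
    same-position-if : ∀ i j → i ≡ j →
      (h : missing i ≢ position e) (h′ : missing j ≢ position f) →
      punchOut h ≡ punchOut h′ → position e ≡ position f
    same-position-if i .i refl h h′ = Fin.punchOut-injective h h′

propositionE1 : Σ ℕ λ C₁ → Σ ℕ λ C₂ → Σ ℚ λ c → (0ℚ < c) ×
    (∀ (a : ℕ) → 1 ≤ a → ∀ (ε : ℝ) → fromℚ 0ℚ <ℝ ε → ε <ℝ fromℚ ½ →
    Σ Multigraph λ G →
    HasArboricity G a ×
    (ℕ→ℚ (order G) · ε ≤ℝ fromℚ (ℕ→ℚ C₁)) ×
    (maxDegree G ≤ C₂ * a) ×
    (∀ (k : ℕ) → fromℚ (ℕ→ℚ k) ≤ℝ ℕ→ℚ a · (fromℚ 1ℚ +ℝ ε) →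
    ∀ (P : ForestDecomposition G k) (D : ℕ) → HasDiameter G P D →
    fromℚ c ≤ℝ ℕ→ℚ D · ε))
-- The first 2 is the bound of `order-bound`, the second counts the sides of a vertex, and ⅓ is the
-- lower bound on (M + 1) ε.
propositionE1 = 2 , 2 , ⅓ , ℚ.positive⁻¹ ⅓ , λ a 1≤a ε 0<ε ε<½ →
  let M , scale = ∃-scale ε 0<ε
      open FatPath (suc M) a
  in fatPath , arboricity-fatPath M a , order-bound scale ε<½ , maxDegree-fatPath ,
     -- It suffices that D > M: if D ≤ M, every class misses a position and the edge count
     -- contradicts the bound on k.
     λ k k≤a[1+ε] P D diam → ⅓≤D·ε scale (ℕ.≰⇒> λ D≤M →
       k≤a[1+ε]⇒[1+M]a≰kM scale a k 1≤a k≤a[1+ε]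
         (short⇒edge-bound M a P diam (ℕ.s≤s D≤M)))
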